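{- Let $\mathscr{D}_n$ be the set of derangements of $[n]=\{1,\dots,n\}$. For every integer $m\ge 2$ and every $0\le r\le m-1$, $$\lim_{n\to\infty}\frac{\left|\{\pi\in\mathscr{D}_n:\ \mathrm{maj}(\pi)\equiv r\pmod m\}\right|}{|\mathscr{D}_n|}=\frac1m .$$ That is, the major index over derangements of $[n]$ has the balanced property.
   Context: A derangement of $[n]$ is a permutation $\pi=\pi_1\pi_2\cdots\pi_n$ of $[n]$ with $\pi_i\ne i$ for all $i$. The major index of a permutation $\pi=\pi_1\cdots\pi_n$ is $\mathrm{maj}(\pi)=\sum_{i:\,\pi_i>\pi_{i+1}} i$. A statistic $\xi$ on sets $Q_n$ has the balanced property if for every $m\ge 2$ and every $0\le r\le m-1$, $\lim_{n\to\infty}|\{\pi\in Q_n:\xi(\pi)\equiv r \pmod m\}|/|Q_n| = 1/m$. -}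

module Defs where

open import Data.Fin.Base as Fin using (Fin; zero; suc; toℕ; inject₁; punchIn)
open import Data.Fin.Permutation using (Permutation′; _⟨$⟩ʳ_; _≈_; id; insert; remove; insert-remove)
import Data.Fin.Properties as Fin
open import Data.Integer.Base using (+_; 1ℤ)
open import Data.List.Base using (List; []; _∷_; length; filter; map; allFin; cartesianProductWith)
import Data.List.Membership.Setoid as Membership
open import Data.List.Membership.Setoid.Properties using (∈-cartesianProductWith⁺; ∈-resp-≈)
open import Data.List.Membership.Propositional.Properties using (∈-allFin)
open import Data.List.Relation.Unary.AllPairs using ([]; _∷_)
open import Data.List.Relation.Unary.All using ([])
open import Data.List.Relation.Unary.Any using (here)
open import Data.List.Relation.Unary.Unique.Setoid using (Unique)
open import Data.List.Relation.Unary.Unique.Setoid.Properties using (cartesianProductWith⁺)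
open import Data.List.Relation.Unary.Unique.Propositional.Properties using (allFin⁺)
open import Data.Nat.Base using (ℕ; zero; suc; _≤_; _<_; ∣_-_∣; NonZero; NonTrivial; nonTrivial⇒nonZero)
open import Data.Nat.Divisibility using (_∣_; _∣?_)
open import Data.Nat.ListAction using (sum)
open import Data.Product.Base using (_×_; _,_; ∃-syntax; Σ-syntax)
open import Data.Rational.Base as ℚ using (ℚ; 0ℚ; _/_)
open import Level using (0ℓ)
open import Relation.Binary.Bundles using (Setoid)
open import Relation.Binary.PropositionalEquality using (_≡_; _≢_; refl; sym; trans; cong; setoid)
open import Relation.Nullary.Decidable using (Dec; ¬?)
open import Relation.Unary using (Pred; Decidable)
open import Relation.Unary.Properties using (_∩?_)

-- Permutations of [n] are library permutations of Fin n, with the value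
-- i : Fin n standing for i + 1 and with pointwise equality _≈_.

permutationSetoid : ℕ → Setoid 0ℓ 0ℓ
permutationSetoid n = record
  { Carrier       = Permutation′ n
  ; _≈_           = _≈_
  ; isEquivalence = record
    { refl  = λ _ → refl
    ; sym   = λ p i → sym (p i)
    ; trans = λ p q i → trans (p i) (q i)
    }
  }

permutations : ∀ n → List (Permutation′ n)
permutations zero    = id ∷ []
permutations (suc n) =
  cartesianProductWith (insert zero) (allFin (suc n)) (permutations n)

private
  insert-cong : ∀ {n} {j k : Fin (suc n)} {π ρ : Permutation′ n} →
                j ≡ k → π ≈ ρ → insert zero j π ≈ insert zero k ρ
  insert-cong             refl π≈ρ zero    = refl
  insert-cong {j = j}     refl π≈ρ (suc i) = cong (punchIn j) (π≈ρ i)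

  insert-injective : ∀ {n} {j k : Fin (suc n)} {π ρ : Permutation′ n} →
                     insert zero j π ≈ insert zero k ρ → j ≡ k × π ≈ ρ
  insert-injective {j = j} {k} {π} {ρ} p with refl ← p zero =
    refl , λ i → Fin.punchIn-injective j (π ⟨$⟩ʳ i) (ρ ⟨$⟩ʳ i) (p (suc i))

-- Every permutation occurs in the list exactly once, up to _≈_.

permutations-complete : ∀ {n} (π : Permutation′ n) →
  let open Membership (permutationSetoid n) in π ∈ permutations n
permutations-complete {zero}  π = here λ ()
permutations-complete {suc n} π =
  ∈-resp-≈ (permutationSetoid (suc n))
    {x = insert zero (π ⟨$⟩ʳ zero) (remove zero π)} {y = π}
    (insert-remove zero π)
    (∈-cartesianProductWith⁺
      (setoid (Fin (suc n))) (permutationSetoid n) (permutationSetoid (suc n))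
      (λ {_} {_} {π} {ρ} → insert-cong {π = π} {ρ = ρ})
      (∈-allFin (π ⟨$⟩ʳ zero)) (permutations-complete (remove zero π)))

permutations-unique : ∀ n → Unique (permutationSetoid n) (permutations n)
permutations-unique zero    = [] ∷ []
permutations-unique (suc n) =
  cartesianProductWith⁺
    (setoid (Fin (suc n))) (permutationSetoid n) (permutationSetoid (suc n))
    (insert zero) (λ {_} {_} {π} {ρ} → insert-injective {π = π} {ρ = ρ})
    (allFin⁺ (suc n)) (permutations-unique n)

-- The cardinality of { π ∈ Sₙ : P π }, for P respecting _≈_.

count : ∀ {n} {P : Pred (Permutation′ n) 0ℓ} → Decidable P → ℕ
count {n} P? = length (filter P? (permutations n))

Derangement : ∀ {n} → Pred (Permutation′ n) 0ℓ
Derangement π = ∀ i → π ⟨$⟩ʳ i ≢ i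

derangement? : ∀ {n} → Decidable (Derangement {n})
derangement? π = Fin.all? λ i → ¬? (π ⟨$⟩ʳ i Fin.≟ i)

-- An index i : Fin n stands for the position i + 1 of a word of length n + 1,
-- so a descent there contributes suc (toℕ i) to the major index.

Descent : ∀ {n} → Permutation′ (suc n) → Pred (Fin n) 0ℓ
Descent π i = π ⟨$⟩ʳ suc i Fin.< π ⟨$⟩ʳ inject₁ i

descent? : ∀ {n} (π : Permutation′ (suc n)) → Decidable (Descent π)
descent? π i = π ⟨$⟩ʳ suc i Fin.<? π ⟨$⟩ʳ inject₁ i

maj : ∀ {n} → Permutation′ n → ℕ
maj {zero}  π = 0
maj {suc n} π = sum (map (λ i → suc (toℕ i)) (filter (descent? π) (allFin n)))

infix 4 _≡_[mod_] _≡?_[mod_]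

_≡_[mod_] : ℕ → ℕ → ℕ → Set
a ≡ b [mod m ] = m ∣ ∣ a - b ∣

_≡?_[mod_] : ∀ a b m → Dec (a ≡ b [mod m ])
a ≡? b [mod m ] = m ∣? ∣ a - b ∣

-- lim a n / d n = L.  The quotient only has to be defined for large n: there
-- is, for instance, no derangement of a one-element set.

QuotientTendsTo : (a d : ℕ → ℕ) → ℚ → Set
QuotientTendsTo a d L =
  ∀ (ε : ℚ) → 0ℚ ℚ.< ε →
  ∃[ N ] ∀ n → N ≤ n →
  Σ[ d≢0 ∈ NonZero (d n) ] ℚ.∣ _/_ (+ a n) (d n) {{d≢0}} ℚ.- L ∣ ℚ.< ε

HasBalancedProperty : {Q : ∀ {n} → Pred (Permutation′ n) 0ℓ} →
                      (∀ {n} → Decidable (Q {n})) →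
                      (∀ {n} → Permutation′ n → ℕ) → Set
HasBalancedProperty Q? ξ =
  ∀ m r .{{_ : NonTrivial m}} → r < m →
  QuotientTendsTo
    (λ n → count {n} (Q? ∩? λ π → ξ π ≡? r [mod m ]))
    (λ n → count {n} Q?)
    (_/_ 1ℤ m {{nonTrivial⇒nonZero m}})

{-# OPTIONS --safe #-}

-- Call a derangement foreign if none of its first m letters lies in [m].
-- Replacing the pattern of these m letters by another one keeps it a foreign
-- derangement.  Adding 1 modulo m to the values of the pattern only moves the
-- descent at its maximum one position to the left, so maj drops by 1 modulo m:
-- a descent at position m, at the end of the pattern, counts as 0.  Hence maj
-- is exactly equidistributed modulo m on foreign derangements.  Transposing the
-- value v with the other values shows that at most |Dₙ| / (n - 2) derangements
-- send i to v, so at most m² |Dₙ| / (n - 2) derangements are not foreign.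

module Submission where

open import Defs
import Algebra.Properties.Semiring.Sum as Sum
open import Data.Empty using (⊥)
open import Data.Fin.Base as Fin using (Fin; zero; suc; toℕ; fromℕ; fromℕ<; inject₁; inject≤; punchIn)
open import Data.Fin.Permutation using (Permutation′; _⟨$⟩ʳ_; _⟨$⟩ˡ_; _≈_; _∘ₚ_; id; flip; insert; remove; permutation; transpose; inverseˡ; inverseʳ; insert-punchIn; insert-remove; remove-insert; punchIn-permute)
import Data.Fin.Properties as Fin
open import Data.Fin.Relation.Unary.Top using (view; ‵fromℕ; ‵inject₁)
open import Data.Integer.Base as ℤ using (-[1+_]; 1ℤ)
import Data.Integer.Properties as ℤ
open import Data.List.Base using (List; []; _∷_; length; filter; map; tabulate; lookup)
open import Data.List.Membership.Propositional.Properties using (∈-lookup)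
import Data.List.Relation.Unary.All as All
open import Data.List.Relation.Unary.Any using (index)
open import Data.List.Relation.Unary.Any.Properties using (lookup-index)
open import Data.List.Relation.Unary.AllPairs using ([]; _∷_)
open import Data.List.Relation.Unary.Unique.Setoid using (Unique)
open import Data.Nat.Base
open import Data.Nat.Divisibility
open import Data.Nat.DivMod using (_mod_; _%_; _/_; m≡m%n+[m/n]*n; m%n%n≡m%n; m%n<n; m<n⇒m%n≡m; [m+kn]%n≡m%n; %-remove-+ʳ)
open import Data.Nat.ListAction using () renaming (sum to sumᴸ)
open import Data.Nat.Properties
open import Data.Nat.Tactic.RingSolver using (solve-∀)
open import Data.Product.Base using (_×_; _,_; proj₁; ∃-syntax; Σ-syntax)
open import Data.Rational.Base as ℚ using (0ℚ)
import Data.Rational.Properties as ℚ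
import Data.Rational.Unnormalised.Base as ℚᵘ
import Data.Rational.Unnormalised.Properties as ℚᵘ
open import Data.Sum.Base using (inj₁; inj₂)
open import Function.Base using (_∘_)
open import Level using (Level; 0ℓ)
open import Relation.Binary.Bundles using (Setoid)
open import Relation.Binary.PropositionalEquality
open import Relation.Nullary using (Dec; yes; no; ¬_; contradiction)
open import Relation.Nullary.Decidable using (_×-dec_; _→-dec_)
open import Relation.Unary using (Pred; Decidable)
open import Relation.Unary.Properties using (_∩?_)

open Sum +-*-semiring
  using (sum; sum-syntax; sum-cong-≗; sum-init-last; sum-permute; ∑-distrib-+; ∑-comm; *-distribˡ-sum)

private
  variable
    ℓ ℓ′ : Level
    A B : Set ℓ
    n : ℕ

-- Indicators and finite sums

𝟙 : Dec A → ℕ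
𝟙 (yes _) = 1
𝟙 (no  _) = 0

𝟙-yes : (A? : Dec A) → A → 𝟙 A? ≡ 1
𝟙-yes (yes _) _ = refl
𝟙-yes (no ¬x) x = contradiction x ¬x

𝟙-no : (A? : Dec A) → ¬ A → 𝟙 A? ≡ 0
𝟙-no (yes x) ¬x = contradiction x ¬x
𝟙-no (no _)  _  = refl

𝟙-mono : (A? : Dec A) (B? : Dec B) → (A → B) → 𝟙 A? ≤ 𝟙 B?
𝟙-mono (no  _) _       _ = z≤n
𝟙-mono (yes _) (yes _) _ = ≤-refl
𝟙-mono (yes x) (no ¬y) f = contradiction (f x) ¬y

𝟙-cong : (A? : Dec A) (B? : Dec B) → (A → B) → (B → A) → 𝟙 A? ≡ 𝟙 B?
𝟙-cong A? B? f g = ≤-antisym (𝟙-mono A? B? f) (𝟙-mono B? A? g)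

𝟙-× : (A? : Dec A) (B? : Dec B) → 𝟙 (A? ×-dec B?) ≡ 𝟙 A? * 𝟙 B?
𝟙-× (yes _) (yes _) = refl
𝟙-× (yes _) (no  _) = refl
𝟙-× (no  _) (yes _) = refl
𝟙-× (no  _) (no  _) = refl

sum-mono-≤ : {f g : Fin n → ℕ} → (∀ i → f i ≤ g i) → sum f ≤ sum g
sum-mono-≤ {zero}  f≤g = z≤n
sum-mono-≤ {suc n} f≤g = +-mono-≤ (f≤g zero) (sum-mono-≤ (f≤g ∘ suc))

f≤sum : (f : Fin n → ℕ) (i : Fin n) → f i ≤ sum f
f≤sum f zero    = m≤m+n _ _
f≤sum f (suc i) = ≤-trans (f≤sum (f ∘ suc) i) (m≤n+m _ _)

sum-const : ∀ n c → ∑[ _ < n ] c ≡ n * c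
sum-const zero    c = refl
sum-const (suc n) c = cong (λ t → c + t) (sum-const n c)

sum-≟ : (f : Fin n → ℕ) (j : Fin n) → ∑[ i < n ] (𝟙 (i Fin.≟ j) * f i) ≡ f j
sum-≟ {suc n} f zero = begin
  f zero + 0 + ∑[ i < n ] 0 ≡⟨ cong (λ t → f zero + 0 + t) (trans (sum-const n 0) (*-zeroʳ n)) ⟩
  f zero + 0 + 0            ≡⟨ trans (+-identityʳ _) (+-identityʳ _) ⟩
  f zero                    ∎
  where open ≡-Reasoning
sum-≟ {suc n} f (suc j) = trans
  (sum-cong-≗ λ i → cong (_* f (suc i)) (𝟙-cong (suc i Fin.≟ suc j) (i Fin.≟ j) Fin.suc-injective (cong suc)))
  (sum-≟ (f ∘ suc) j)

sum-unique : {P : Pred (Fin n) ℓ} (P? : Decidable P) (j : Fin n) →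
             P j → (∀ {i} → P i → i ≡ j) → ∑[ i < n ] 𝟙 (P? i) ≡ 1
sum-unique P? j Pj unique = trans
  (sum-cong-≗ λ i → trans (𝟙-cong (P? i) (i Fin.≟ j) unique λ { refl → Pj }) (sym (*-identityʳ _)))
  (sum-≟ (λ _ → 1) j)

length-filter : {P : Pred A ℓ} (P? : Decidable P) (xs : List A) →
                length (filter P? xs) ≡ ∑[ i < length xs ] 𝟙 (P? (lookup xs i))
length-filter P? []       = refl
length-filter P? (x ∷ xs) with P? x
... | yes _ = cong suc (length-filter P? xs)
... | no  _ = length-filter P? xs

sum-filter-tabulate : {P : Pred A ℓ} (P? : Decidable P) (g : A → ℕ) (f : Fin n → A) →
  sumᴸ (map g (filter P? (tabulate f))) ≡ ∑[ i < n ] (𝟙 (P? (f i)) * g (f i))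
sum-filter-tabulate {n = zero}  P? g f = refl
sum-filter-tabulate {n = suc n} P? g f with P? (f zero)
... | yes _ = cong₂ _+_ (sym (*-identityˡ (g (f zero)))) (sum-filter-tabulate P? g (f ∘ suc))
... | no  _ = sum-filter-tabulate P? g (f ∘ suc)

-- Enumerations without repetition.

module _ (S : Setoid ℓ ℓ′) where
  open Setoid S using () renaming (Carrier to X; _≈_ to _≈ₛ_; sym to symₛ)

  -- This turns pointwise identities between listed permutations into identities between their
  -- positions.
  lookup-injective : {xs : List X} → Unique S xs → ∀ i j → lookup xs i ≈ₛ lookup xs j → i ≡ j
  lookup-injective (_ ∷ _)         zero    zero    _ = refl
  lookup-injective (x≉xs ∷ _)      zero    (suc j) e = contradiction e (All.lookup x≉xs (∈-lookup j))
  lookup-injective (x≉xs ∷ _)      (suc i) zero    e = contradiction (symₛ e) (All.lookup x≉xs (∈-lookup i))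
  lookup-injective (_ ∷ unique-xs) (suc i) (suc j) e = cong suc (lookup-injective unique-xs i j e)

-- Sums over Sₙ are sums over the positions in its enumeration, so that a
-- bijection of Sₙ becomes a permutation of these positions.

∑ₚ : (Permutation′ n → ℕ) → ℕ
∑ₚ {n} f = ∑[ i < length (permutations n) ] f (lookup (permutations n) i)

count-∑ₚ : {P : Pred (Permutation′ n) 0ℓ} (P? : Decidable P) → count P? ≡ ∑ₚ λ π → 𝟙 (P? π)
count-∑ₚ {n} P? = length-filter P? (permutations n)

-- Pointwise equal elements of `Permutation′ n` need not be propositionally equal, so a summand has
-- to be invariant before a permutation may be exchanged for its listed representative.
Respects : (Permutation′ n → A) → Set _
Respects f = ∀ π ρ → π ≈ ρ → f π ≡ f ρ

module _ (φ ψ : Permutation′ n → Permutation′ n)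
         (φ-cong : ∀ {π ρ} → π ≈ ρ → φ π ≈ φ ρ) (ψ-cong : ∀ {π ρ} → π ≈ ρ → ψ π ≈ ψ ρ)
         (φψ : ∀ π → φ (ψ π) ≈ π) (ψφ : ∀ π → ψ (φ π) ≈ π) where

  private
    S = permutationSetoid n
    at = lookup (permutations n)

    position : Permutation′ n → Fin (length (permutations n))
    position π = index (permutations-complete π)

    at-position : ∀ π → at (position π) ≈ π
    at-position π i = sym (lookup-index (permutations-complete π) i)

    inverse : ∀ {f g : Permutation′ n → Permutation′ n} →
              (∀ {π ρ} → π ≈ ρ → f π ≈ f ρ) → (∀ π → f (g π) ≈ π) →
              ∀ i → position (f (at (position (g (at i))))) ≡ i
    inverse {f} {g} f-cong fg i = lookup-injective S (permutations-unique n) _ i λ j →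
      trans (at-position _ j)
        (trans (f-cong {at (position (g (at i)))} {g (at i)} (at-position (g (at i))) j) (fg (at i) j))

  -- `φ` may leave the list, so it is followed by the passage to the listed representative. The maps
  -- of positions obtained from `φ` and `ψ` are mutually inverse because the enumeration has no
  -- repetitions.
  ∑ₚ-bijection : ∀ {f} → Respects f → ∑ₚ f ≡ ∑ₚ (f ∘ φ)
  ∑ₚ-bijection {f} f-resp = trans
    (sum-permute (f ∘ at) (permutation (position ∘ φ ∘ at) (position ∘ ψ ∘ at)
      (inverse {φ} {ψ} φ-cong φψ) (inverse {ψ} {φ} ψ-cong ψφ)))
    (sum-cong-≗ λ i → f-resp (at (position (φ (at i)))) (φ (at i)) (at-position (φ (at i))))

-- The major index of a word and of its initial segment

maj-∑ : (π : Permutation′ (suc n)) → maj π ≡ ∑[ i < n ] (𝟙 (descent? π i) * suc (toℕ i))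
maj-∑ π = sum-filter-tabulate (descent? π) (λ i → suc (toℕ i)) (λ i → i)

maj-cong : Respects (maj {n})
maj-cong {zero}  π ρ π≈ρ = refl
maj-cong {suc n} π ρ π≈ρ = begin
  maj π                                           ≡⟨ maj-∑ π ⟩
  ∑[ i < n ] (𝟙 (descent? π i) * suc (toℕ i))     ≡⟨ sum-cong-≗ (λ i → cong (_* suc (toℕ i)) (same i)) ⟩
  ∑[ i < n ] (𝟙 (descent? ρ i) * suc (toℕ i))     ≡⟨ maj-∑ ρ ⟨
  maj ρ                                           ∎
  where
  open ≡-Reasoning
  same : ∀ i → 𝟙 (descent? π i) ≡ 𝟙 (descent? ρ i)
  same i = cong₂ (λ u v → 𝟙 (v Fin.<? u)) (π≈ρ (inject₁ i)) (π≈ρ (suc i))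

punchIn-fromℕ : (i : Fin n) → punchIn (fromℕ n) i ≡ inject₁ i
punchIn-fromℕ zero    = refl
punchIn-fromℕ (suc i) = cong suc (punchIn-fromℕ i)

punchIn-mono-< : ∀ i (j k : Fin n) → j Fin.< k → punchIn i j Fin.< punchIn i k
punchIn-mono-< i j k j<k = ≰⇒> (<⇒≱ j<k ∘ Fin.punchIn-cancel-≤ i k j)

punchIn-cancel-< : ∀ i (j k : Fin n) → punchIn i j Fin.< punchIn i k → j Fin.< k
punchIn-cancel-< i j k lt = ≰⇒> (<⇒≱ lt ∘ Fin.punchIn-mono-≤ i k j)

insert-same : ∀ i j (π : Permutation′ n) → insert i j π ⟨$⟩ʳ i ≡ j
insert-same i j π with i Fin.≟ i
... | yes _  = refl
... | no i≢i = contradiction refl i≢i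

insert-inject₁ : ∀ j (π : Permutation′ n) i → insert (fromℕ n) j π ⟨$⟩ʳ inject₁ i ≡ punchIn j (π ⟨$⟩ʳ i)
insert-inject₁ {n} j π i = subst (λ k → insert (fromℕ n) j π ⟨$⟩ʳ k ≡ punchIn j (π ⟨$⟩ʳ i))
  (punchIn-fromℕ i) (insert-punchIn (fromℕ n) j π i)

-- `remove` standardises the remaining letters; their relative order survives because `punchIn` is
-- increasing.
init : Permutation′ (suc n) → Permutation′ n
init {n} = remove (fromℕ n)

init-inject₁ : (π : Permutation′ (suc n)) (i : Fin n) →
               π ⟨$⟩ʳ inject₁ i ≡ punchIn (π ⟨$⟩ʳ fromℕ n) (init π ⟨$⟩ʳ i)
init-inject₁ {n} π i = trans (cong (π ⟨$⟩ʳ_) (sym (punchIn-fromℕ i))) (punchIn-permute π (fromℕ n) i)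

-- Standardising keeps all comparisons among the earlier letters, so only a descent at the last
-- position can be lost.
maj-init : (π : Permutation′ (2+ n)) →
           maj π ≡ maj (init π) + 𝟙 (descent? π (fromℕ n)) * suc n
maj-init {n} π = begin
  maj π
    ≡⟨ maj-∑ π ⟩
  sum weight
    ≡⟨ sum-init-last weight ⟩
  ∑[ i < n ] weight (inject₁ i) + weight (fromℕ n)
    ≡⟨ cong₂ _+_ (sum-cong-≗ same) (cong (λ k → 𝟙 (descent? π (fromℕ n)) * suc k) (Fin.toℕ-fromℕ n)) ⟩
  ∑[ i < n ] (𝟙 (descent? (init π) i) * suc (toℕ i)) + 𝟙 (descent? π (fromℕ n)) * suc n
    ≡⟨ cong (_+ 𝟙 (descent? π (fromℕ n)) * suc n) (maj-∑ (init π)) ⟨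
  maj (init π) + 𝟙 (descent? π (fromℕ n)) * suc n
    ∎
  where
  open ≡-Reasoning
  weight : Fin (suc n) → ℕ
  weight i = 𝟙 (descent? π i) * suc (toℕ i)
  last : Fin (2+ n)
  last = π ⟨$⟩ʳ fromℕ (suc n)
  same : ∀ i → weight (inject₁ i) ≡ 𝟙 (descent? (init π) i) * suc (toℕ i)
  same i = cong₂ (λ x k → x * suc k)
    (𝟙-cong (descent? π (inject₁ i)) (descent? (init π) i)
      (λ lt → punchIn-cancel-< last _ _ (subst₂ Fin._<_ (init-inject₁ π (suc i)) (init-inject₁ π (inject₁ i)) lt))
      (λ lt → subst₂ Fin._<_ (sym (init-inject₁ π (suc i))) (sym (init-inject₁ π (inject₁ i))) (punchIn-mono-< last _ _ lt)))
    (Fin.toℕ-inject₁ i)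

-- Rotating the values of a permutation

-- The cycle that adds 1 modulo `suc n`: giving the last argument the value `zero` pushes the other
-- values of the identity up by one.
rotate : Permutation′ (suc n)
rotate {n} = insert (fromℕ n) zero id

rotate-fromℕ : rotate ⟨$⟩ʳ fromℕ n ≡ zero
rotate-fromℕ {n} = insert-same (fromℕ n) zero id

rotate-inject₁ : (i : Fin n) → rotate ⟨$⟩ʳ inject₁ i ≡ suc i
rotate-inject₁ i = insert-inject₁ zero id i

inject₁-mono-< : {i j : Fin n} → i Fin.< j → inject₁ i Fin.< inject₁ j
inject₁-mono-< {i = i} {j} = subst₂ _<_ (sym (Fin.toℕ-inject₁ i)) (sym (Fin.toℕ-inject₁ j))

inject₁-cancel-< : {i j : Fin n} → inject₁ i Fin.< inject₁ j → i Fin.< j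
inject₁-cancel-< {i = i} {j} = subst₂ _<_ (Fin.toℕ-inject₁ i) (Fin.toℕ-inject₁ j)

inject₁<fromℕ : (i : Fin n) → inject₁ i Fin.< fromℕ n
inject₁<fromℕ {n} i = subst (toℕ (inject₁ i) <_) (sym (Fin.toℕ-fromℕ n)) (Fin.inject₁ℕ< i)

-- Only comparisons with the largest value change, as it becomes the smallest.

rotate-descent : (u v : Fin (suc n)) → u ≢ v →
  𝟙 ((rotate ⟨$⟩ʳ v) Fin.<? (rotate ⟨$⟩ʳ u)) + 𝟙 (u Fin.≟ fromℕ n) ≡
  𝟙 (v Fin.<? u) + 𝟙 (v Fin.≟ fromℕ n)
rotate-descent {n} u v u≢v with view u | view v
... | ‵fromℕ     | ‵fromℕ     = contradiction refl u≢v
... | ‵fromℕ     | ‵inject₁ j = trans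
  (cong₂ _+_ (𝟙-no (rotate ⟨$⟩ʳ inject₁ j Fin.<? rotate ⟨$⟩ʳ fromℕ n) λ lt → n≮0 (subst (rotate ⟨$⟩ʳ inject₁ j Fin.<_) rotate-fromℕ lt)) (𝟙-yes (_ Fin.≟ _) refl))
  (sym (cong₂ _+_ (𝟙-yes (_ Fin.<? _) (inject₁<fromℕ j)) (𝟙-no (_ Fin.≟ _) (Fin.fromℕ≢inject₁ ∘ sym))))
... | ‵inject₁ i | ‵fromℕ     = trans
  (cong₂ _+_ (𝟙-yes (rotate ⟨$⟩ʳ fromℕ n Fin.<? rotate ⟨$⟩ʳ inject₁ i) (subst₂ Fin._<_ (sym rotate-fromℕ) (sym (rotate-inject₁ i)) z<s))
             (𝟙-no (_ Fin.≟ _) (Fin.fromℕ≢inject₁ ∘ sym)))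
  (sym (cong₂ _+_ (𝟙-no (_ Fin.<? _) (<-asym (inject₁<fromℕ i))) (𝟙-yes (_ Fin.≟ _) refl)))
... | ‵inject₁ i | ‵inject₁ j = cong₂ _+_
  (𝟙-cong (rotate ⟨$⟩ʳ inject₁ j Fin.<? rotate ⟨$⟩ʳ inject₁ i) (inject₁ j Fin.<? inject₁ i)
    (inject₁-mono-< ∘ s<s⁻¹ ∘ subst₂ Fin._<_ (rotate-inject₁ j) (rotate-inject₁ i))
    (subst₂ Fin._<_ (sym (rotate-inject₁ j)) (sym (rotate-inject₁ i)) ∘ s<s ∘ inject₁-cancel-<))
  (trans (𝟙-no (_ Fin.≟ _) (Fin.fromℕ≢inject₁ ∘ sym)) (sym (𝟙-no (_ Fin.≟ _) (Fin.fromℕ≢inject₁ ∘ sym))))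

⟨$⟩ʳ-injective : (π : Permutation′ n) {i j : Fin n} → π ⟨$⟩ʳ i ≡ π ⟨$⟩ʳ j → i ≡ j
⟨$⟩ʳ-injective π eq = trans (sym (inverseˡ π)) (trans (cong (π ⟨$⟩ˡ_) eq) (inverseˡ π))

inject₁≢suc : (i : Fin n) → inject₁ i ≢ suc i
inject₁≢suc (suc i) = inject₁≢suc i ∘ Fin.suc-injective

module _ (π : Permutation′ (suc n)) where

  private
    -- The position of the largest letter, counted from 0; `c` is 1 exactly when no letter follows
    -- it.
    p = π ⟨$⟩ˡ fromℕ n
    c = 𝟙 (fromℕ n Fin.≟ p)

    value-max : ∀ i → 𝟙 (π ⟨$⟩ʳ i Fin.≟ fromℕ n) ≡ 𝟙 (i Fin.≟ p)
    value-max i = 𝟙-cong (π ⟨$⟩ʳ i Fin.≟ fromℕ n) (i Fin.≟ p)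
      (λ e → trans (sym (inverseˡ π)) (cong (π ⟨$⟩ˡ_) e)) (λ { refl → inverseʳ π })

    -- The weight of the gap left of the largest letter. If that letter comes first there is no such
    -- gap, and its position 0 is still the right value.
    sum-p : ∑[ i < n ] (𝟙 (suc i Fin.≟ p) * suc (toℕ i)) ≡ toℕ p
    -- The term at `zero` has weight 0 and completes the sum to all positions.
    sum-p = trans (cong (_+ ∑[ i < n ] (𝟙 (suc i Fin.≟ p) * suc (toℕ i))) (sym (*-zeroʳ (𝟙 (zero Fin.≟ p)))))
                  (sum-≟ toℕ p)

    -- The weight of the gap right of the largest letter. At the end of the word this gap is
    -- missing, and `c * suc n` stands in for it.
    sum-1+p : ∑[ i < n ] (𝟙 (inject₁ i Fin.≟ p) * suc (toℕ i)) + c * suc n ≡ suc (toℕ p)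
    sum-1+p = begin
      ∑[ i < n ] (𝟙 (inject₁ i Fin.≟ p) * suc (toℕ i)) + c * suc n
        ≡⟨ cong₂ _+_ (sum-cong-≗ λ i → cong (λ k → 𝟙 (inject₁ i Fin.≟ p) * suc k) (Fin.toℕ-inject₁ i))
                     (cong (λ k → c * suc k) (Fin.toℕ-fromℕ n)) ⟨
      ∑[ i < n ] (𝟙 (inject₁ i Fin.≟ p) * suc (toℕ (inject₁ i))) + c * suc (toℕ (fromℕ n))
        ≡⟨ sum-init-last (λ i → 𝟙 (i Fin.≟ p) * suc (toℕ i)) ⟨
      ∑[ i < suc n ] (𝟙 (i Fin.≟ p) * suc (toℕ i))
        ≡⟨ sum-≟ (suc ∘ toℕ) p ⟩
      suc (toℕ p) ∎
      where open ≡-Reasoning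

    -- This is `rotate-descent` for neighbouring letters, distinct by injectivity, with the largest
    -- value traced back to its position.
    pointwise : ∀ i →
      𝟙 (descent? (π ∘ₚ rotate) i) + 𝟙 (inject₁ i Fin.≟ p) ≡ 𝟙 (descent? π i) + 𝟙 (suc i Fin.≟ p)
    pointwise i = begin
      𝟙 (descent? (π ∘ₚ rotate) i) + 𝟙 (inject₁ i Fin.≟ p)
        ≡⟨ cong (𝟙 (descent? (π ∘ₚ rotate) i) +_) (value-max (inject₁ i)) ⟨
      𝟙 (descent? (π ∘ₚ rotate) i) + 𝟙 (π ⟨$⟩ʳ inject₁ i Fin.≟ fromℕ n)
        ≡⟨ rotate-descent (π ⟨$⟩ʳ inject₁ i) (π ⟨$⟩ʳ suc i) (inject₁≢suc i ∘ ⟨$⟩ʳ-injective π) ⟩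
      𝟙 (descent? π i) + 𝟙 (π ⟨$⟩ʳ suc i Fin.≟ fromℕ n)
        ≡⟨ cong (𝟙 (descent? π i) +_) (value-max (suc i)) ⟩
      𝟙 (descent? π i) + 𝟙 (suc i Fin.≟ p) ∎
      where open ≡-Reasoning

    sum-+-* : (f g : Fin n → ℕ) → ∑[ i < n ] ((f i + g i) * suc (toℕ i)) ≡
      ∑[ i < n ] (f i * suc (toℕ i)) + ∑[ i < n ] (g i * suc (toℕ i))
    sum-+-* f g = trans (sum-cong-≗ λ i → *-distribʳ-+ (suc (toℕ i)) (f i) (g i)) (∑-distrib-+ {n} _ _)

  -- Weighted summation of `pointwise` trades the weight `suc (toℕ p)` right of the largest letter
  -- for the weight `toℕ p` on its left. If that letter is last, `c` is 1 and the gain of `n` is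
  -- again a loss of 1 modulo `suc n`.
  maj-rotate : ∃[ c ] suc (maj (π ∘ₚ rotate)) ≡ maj π + c * suc n
  -- Adding `toℕ p` to both sides avoids subtraction.
  maj-rotate = c , +-cancelʳ-≡ (toℕ p) _ _ (begin
    suc (maj (π ∘ₚ rotate)) + toℕ p                                     ≡⟨ +-suc _ _ ⟨
    maj (π ∘ₚ rotate) + suc (toℕ p)                                     ≡⟨ cong₂ _+_ (maj-∑ (π ∘ₚ rotate)) (sym sum-1+p) ⟩
    ∑[ i < n ] (𝟙 (descent? (π ∘ₚ rotate) i) * suc (toℕ i)) + (_ + c * suc n) ≡⟨ +-assoc (∑[ i < n ] (𝟙 (descent? (π ∘ₚ rotate) i) * suc (toℕ i))) _ _ ⟨
    ∑[ i < n ] (𝟙 (descent? (π ∘ₚ rotate) i) * suc (toℕ i)) + _ + c * suc n   ≡⟨ cong (_+ c * suc n) (sum-+-* (λ i → 𝟙 (descent? (π ∘ₚ rotate) i)) (λ i → 𝟙 (inject₁ i Fin.≟ p))) ⟨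
    ∑[ i < n ] ((𝟙 (descent? (π ∘ₚ rotate) i) + 𝟙 (inject₁ i Fin.≟ p)) * suc (toℕ i)) + c * suc n ≡⟨ cong (_+ c * suc n) (sum-cong-≗ λ i → cong (_* suc (toℕ i)) (pointwise i)) ⟩
    ∑[ i < n ] ((𝟙 (descent? π i) + 𝟙 (suc i Fin.≟ p)) * suc (toℕ i)) + c * suc n ≡⟨ cong (_+ c * suc n) (sum-+-* (λ i → 𝟙 (descent? π i)) (λ i → 𝟙 (suc i Fin.≟ p))) ⟩
    ∑[ i < n ] (𝟙 (descent? π i) * suc (toℕ i)) + _ + c * suc n ≡⟨ cong₂ (λ x y → x + y + c * suc n) (sym (maj-∑ π)) sum-p ⟩
    maj π + toℕ p + c * suc n ≡⟨ rearrange (maj π) (toℕ p) (c * suc n) ⟩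
    maj π + c * suc n + toℕ p ∎)
    where
    open ≡-Reasoning
    rearrange : ∀ x y z → x + y + z ≡ x + z + y
    rearrange = solve-∀

-- Congruence

module _ {m : ℕ} where

  ≡mod-sym : ∀ {a b} → a ≡ b [mod m ] → b ≡ a [mod m ]
  ≡mod-sym {a} {b} = subst (m ∣_) (∣-∣-comm a b)

  ≡mod-+ʳ : ∀ {a b} c → a ≡ b [mod m ] → a + c ≡ b + c [mod m ]
  ≡mod-+ʳ {a} {b} c = subst (m ∣_) (begin
    ∣ a - b ∣           ≡⟨ ∣m+n-m+o∣≡∣n-o∣ c a b ⟨
    ∣ c + a - c + b ∣   ≡⟨ cong₂ ∣_-_∣ (+-comm c a) (+-comm c b) ⟩
    ∣ a + c - b + c ∣   ∎)
    where open ≡-Reasoning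

  module _ .{{_ : NonZero m}} where

    ≡mod⇒%≡% : ∀ {a b} → a ≡ b [mod m ] → a % m ≡ b % m
    ≡mod⇒%≡% {a} {b} m∣a-b with ≤-total a b
    ... | inj₁ a≤b = begin
      a % m             ≡⟨ %-remove-+ʳ a (subst (m ∣_) (m≤n⇒∣m-n∣≡n∸m a≤b) m∣a-b) ⟨
      (a + (b ∸ a)) % m ≡⟨ cong (_% m) (m+[n∸m]≡n a≤b) ⟩
      b % m             ∎
      where open ≡-Reasoning
    ... | inj₂ b≤a = begin
      a % m             ≡⟨ cong (_% m) (m+[n∸m]≡n b≤a) ⟨
      (b + (a ∸ b)) % m ≡⟨ %-remove-+ʳ b (subst (m ∣_) (trans (∣-∣-comm a b) (m≤n⇒∣m-n∣≡n∸m b≤a)) m∣a-b) ⟩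
      b % m             ∎
      where open ≡-Reasoning

    %≡%⇒≡mod : ∀ {a b} → a % m ≡ b % m → a ≡ b [mod m ]
    %≡%⇒≡mod {a} {b} eq = divides ∣ a / m - b / m ∣ (begin
      ∣ a - b ∣
        ≡⟨ cong₂ ∣_-_∣ (m≡m%n+[m/n]*n a m) (trans (m≡m%n+[m/n]*n b m) (cong (λ r → r + b / m * m) (sym eq))) ⟩
      ∣ a % m + a / m * m - a % m + b / m * m ∣
        ≡⟨ ∣m+n-m+o∣≡∣n-o∣ (a % m) _ _ ⟩
      ∣ a / m * m - b / m * m ∣
        ≡⟨ *-distribʳ-∣-∣ m (a / m) (b / m) ⟨
      ∣ a / m - b / m ∣ * m
        ∎)
      where open ≡-Reasoning

    -- Proved through remainders, because absolute differences are not additive.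
    ≡mod-trans : ∀ {a b c} → a ≡ b [mod m ] → b ≡ c [mod m ] → a ≡ c [mod m ]
    ≡mod-trans {a} {b} {c} p q = %≡%⇒≡mod {a} {c} (trans (≡mod⇒%≡% {a} {b} p) (≡mod⇒%≡% {b} {c} q))

    +*-≡mod : ∀ a k → a + k * m ≡ a [mod m ]
    +*-≡mod a k = %≡%⇒≡mod {a + k * m} {a} ([m+kn]%n≡m%n a k m)

    -- The one residue hit is `a mod m`. Summed over permutations, this splits a count into its `m`
    -- residue classes.
    residue-sum : ∀ a → ∑[ r < m ] 𝟙 (a ≡? toℕ r [mod m ]) ≡ 1
    residue-sum a = sum-unique (λ r → a ≡? toℕ r [mod m ]) (a mod m)
      (%≡%⇒≡mod {a} {toℕ (a mod m)}
        (trans (sym (m%n%n≡m%n a m)) (cong (_% m) (sym (Fin.toℕ-fromℕ< (m%n<n a m))))))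
      λ {r} a≡r → Fin.toℕ-injective (begin
        toℕ r           ≡⟨ m<n⇒m%n≡m (Fin.toℕ<n r) ⟨
        toℕ r % m       ≡⟨ ≡mod⇒%≡% {a} {toℕ r} a≡r ⟨
        a % m           ≡⟨ Fin.toℕ-fromℕ< (m%n<n a m) ⟨
        toℕ (a mod m)   ∎)
      where open ≡-Reasoning

-- Rearranging the first letters of a word

insert-cong : ∀ i {j k} {π ρ : Permutation′ n} → j ≡ k → π ≈ ρ → insert i j π ≈ insert i k ρ
insert-cong i {j} refl π≈ρ l with i Fin.≟ l
... | yes _ = refl
... | no  _ = cong (punchIn j) (π≈ρ _)

init-cong : {π ρ : Permutation′ (suc n)} → π ≈ ρ → init π ≈ init ρ
init-cong {n} {π} {ρ} π≈ρ i = Fin.punchIn-injective (π ⟨$⟩ʳ fromℕ n) _ _ (begin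
  punchIn (π ⟨$⟩ʳ fromℕ n) (init π ⟨$⟩ʳ i) ≡⟨ init-inject₁ π i ⟨
  π ⟨$⟩ʳ inject₁ i                         ≡⟨ π≈ρ (inject₁ i) ⟩
  ρ ⟨$⟩ʳ inject₁ i                         ≡⟨ init-inject₁ ρ i ⟩
  punchIn (ρ ⟨$⟩ʳ fromℕ n) (init ρ ⟨$⟩ʳ i) ≡⟨ cong (λ j → punchIn j (init ρ ⟨$⟩ʳ i)) (π≈ρ (fromℕ n)) ⟨
  punchIn (π ⟨$⟩ʳ fromℕ n) (init ρ ⟨$⟩ʳ i) ∎)
  where open ≡-Reasoning

-- Rearranges the first suc M letters of a word: their pattern in
-- S_{suc M} is composed with c, and the other letters stay in place.

onHead : ∀ {M} → Permutation′ (suc M) → ∀ k → Permutation′ (suc (k + M)) → Permutation′ (suc (k + M))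
onHead c zero    π = π ∘ₚ c
onHead c (suc k) π = insert (fromℕ _) (π ⟨$⟩ʳ fromℕ _) (onHead c k (init π))

module _ {M : ℕ} where

  onHead-cong : ∀ (c : Permutation′ (suc M)) k {π ρ} → π ≈ ρ → onHead c k π ≈ onHead c k ρ
  onHead-cong c zero            π≈ρ i = cong (c ⟨$⟩ʳ_) (π≈ρ i)
  onHead-cong c (suc k) {π} {ρ} π≈ρ   =
    insert-cong (fromℕ _) {π = onHead c k (init π)} {onHead c k (init ρ)} (π≈ρ (fromℕ _))
      (onHead-cong c k {init π} {init ρ} (init-cong {π = π} {ρ} π≈ρ))

  -- The inner call keeps the last letter, so the outer one strips and restores that same letter;
  -- between the two, the induction hypothesis acts on the initial segment.
  onHead-inverse : (c d : Permutation′ (suc M)) → (∀ i → c ⟨$⟩ʳ (d ⟨$⟩ʳ i) ≡ i) →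
                   ∀ k π → onHead c k (onHead d k π) ≈ π
  onHead-inverse c d cd zero    π i = cd _
  onHead-inverse c d cd (suc k) π i = trans
    (insert-cong last {π = onHead c k (init π′)} {init π} (insert-same last (π ⟨$⟩ʳ last) (onHead d k (init π)))
      (λ j → trans
        (onHead-cong c k {init π′} {onHead d k (init π)}
          (remove-insert last (π ⟨$⟩ʳ last) (onHead d k (init π))) j)
        (onHead-inverse c d cd k (init π) j)) i)
    (insert-remove last π i)
    where
    last = fromℕ (suc (k + M))
    π′   = onHead d (suc k) π

  -- For `k` zero the head is the whole word. Otherwise the last letter is reinserted with its
  -- value, and an earlier tail letter is fixed in the standardised initial segment, hence also
  -- after `punchIn` around the same last letter.
  onHead-tail : ∀ (c : Permutation′ (suc M)) k π i → suc M ≤ toℕ i → onHead c k π ⟨$⟩ʳ i ≡ π ⟨$⟩ʳ i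
  onHead-tail c zero    π i m≤i = contradiction m≤i (<⇒≱ (Fin.toℕ<n i))
  onHead-tail c (suc k) π i m≤i with view i
  ... | ‵fromℕ     = insert-same (fromℕ _) (π ⟨$⟩ʳ fromℕ _) (onHead c k (init π))
  ... | ‵inject₁ j = begin
    onHead c (suc k) π ⟨$⟩ʳ inject₁ j                      ≡⟨ insert-inject₁ (π ⟨$⟩ʳ fromℕ _) (onHead c k (init π)) j ⟩
    punchIn (π ⟨$⟩ʳ fromℕ _) (onHead c k (init π) ⟨$⟩ʳ j)  ≡⟨ cong (punchIn _) (onHead-tail c k (init π) j (subst (suc M ≤_) (Fin.toℕ-inject₁ j) m≤i)) ⟩
    punchIn (π ⟨$⟩ʳ fromℕ _) (init π ⟨$⟩ʳ j)               ≡⟨ init-inject₁ π j ⟨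
    π ⟨$⟩ʳ inject₁ j                                       ∎
    where open ≡-Reasoning

  private
    -- The summand that `maj-init` splits off.
    boundary : ∀ k → Permutation′ (2+ (k + M)) → ℕ
    boundary k π = 𝟙 (descent? π (fromℕ (k + M))) * suc (k + M)

  -- For k = 0 this descent counts suc M ≡ 0; otherwise it is right of the head.

  boundary-onHead : ∀ c k π a → a + boundary k (onHead c (suc k) π) ≡ a + boundary k π [mod suc M ]
  boundary-onHead c zero    π a = ≡mod-trans {a = a + x * suc M} {a} {a + y * suc M}
    (+*-≡mod a x) (≡mod-sym {a = a + y * suc M} (+*-≡mod a y))
    where
    x = 𝟙 (descent? (onHead c 1 π) (fromℕ M))
    y = 𝟙 (descent? π (fromℕ M))
  boundary-onHead c (suc k) π a = subst (λ b → a + b ≡ a + boundary (suc k) π [mod suc M ])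
    (cong₂ (λ u v → 𝟙 (v Fin.<? u) * (2+ (k + M)))
      (sym (onHead-tail c (2+ k) π (inject₁ (fromℕ (suc k + M)))
        (subst (suc M ≤_) (sym (trans (Fin.toℕ-inject₁ _) (Fin.toℕ-fromℕ (suc k + M)))) (s≤s (m≤n+m M k)))))
      (sym (onHead-tail c (2+ k) π (fromℕ (2+ k + M))
        (subst (suc M ≤_) (sym (Fin.toℕ-fromℕ (2+ k + M))) (s≤s (m≤n+m M (suc k)))))))
    (subst (suc M ∣_) (sym (∣n-n∣≡0 (a + boundary (suc k) π))) (suc M ∣0))

  -- `maj-rotate` settles the word that is all head. Each further letter contributes only its
  -- boundary term, which `boundary-onHead` shows to be unchanged modulo `suc M`.
  maj-onHead-rotate : ∀ k (π : Permutation′ (suc (k + M))) →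
                      suc (maj (onHead rotate k π)) ≡ maj π [mod suc M ]
  maj-onHead-rotate zero    π with c , eq ← maj-rotate π =
    subst (_≡ maj π [mod suc M ]) (sym eq) (+*-≡mod (maj π) c)
  maj-onHead-rotate (suc k) π =
    subst₂ (_≡_[mod suc M ]) (cong suc (sym (maj-init π′))) (sym (maj-init π))
      (≡mod-trans {a = suc (maj (init π′)) + boundary k π′} {maj (init π) + boundary k π′} {maj (init π) + boundary k π}
        (≡mod-+ʳ {a = suc (maj (init π′))} {maj (init π)} (boundary k π′) ih)
        (boundary-onHead rotate k π (maj (init π))))
    where
    π′ = onHead rotate (suc k) π
    -- Stripping the reinserted letter gives back `onHead rotate k (init π)` only pointwise, hence
    -- `maj-cong`.
    ih : suc (maj (init π′)) ≡ maj (init π) [mod suc M ]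
    ih = subst (λ x → suc x ≡ maj (init π) [mod suc M ])
      (maj-cong (onHead rotate k (init π)) (init π′)
        (λ i → sym (remove-insert (fromℕ (suc k + M)) (π ⟨$⟩ʳ fromℕ (suc k + M)) (onHead rotate k (init π)) i)))
      (maj-onHead-rotate k (init π))

-- Foreign derangements

Foreign : ℕ → Pred (Permutation′ n) 0ℓ
Foreign m π = ∀ i → toℕ i < m → m ≤ toℕ (π ⟨$⟩ʳ i)

foreign? : ∀ m → Decidable (Foreign {n} m)
foreign? m π = Fin.all? λ i → (toℕ i <? m) →-dec (m ≤? toℕ (π ⟨$⟩ʳ i))

ForeignDerangement : ℕ → Pred (Permutation′ n) 0ℓ
ForeignDerangement m π = Derangement π × Foreign m π

foreignDerangement? : ∀ m → Decidable (ForeignDerangement {n} m)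
foreignDerangement? m π = derangement? π ×-dec foreign? m π

-- Being foreign depends on the tail alone: it says that every value below `m` sits at a position
-- not below `m`. The position `j` where `π` takes the value of `ρ` at `i` is such a position, and
-- there the two words agree.
foreign-tail : ∀ {m} (π ρ : Permutation′ n) → (∀ i → m ≤ toℕ i → π ⟨$⟩ʳ i ≡ ρ ⟨$⟩ʳ i) →
               Foreign m π → Foreign m ρ
foreign-tail {m = m} π ρ same foreign i i<m = ≮⇒≥ λ v<m →
  let j   = π ⟨$⟩ˡ (ρ ⟨$⟩ʳ i)
      m≤j = ≮⇒≥ λ j<m → <⇒≱ v<m (subst (λ k → m ≤ toℕ k) (inverseʳ π) (foreign j j<m))
      j≡i = ⟨$⟩ʳ-injective ρ (trans (sym (same j m≤j)) (inverseʳ π))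
  in <⇒≱ i<m (subst (λ k → m ≤ toℕ k) j≡i m≤j)

-- A foreign word has no fixed point in its head, and the tails agree.
foreignDerangement-tail : ∀ {m} (π ρ : Permutation′ n) → (∀ i → m ≤ toℕ i → π ⟨$⟩ʳ i ≡ ρ ⟨$⟩ʳ i) →
                          ForeignDerangement m π → ForeignDerangement m ρ
foreignDerangement-tail {m = m} π ρ same (deranged , foreign) = deranged′ , foreign′
  where
  foreign′ = foreign-tail π ρ same foreign
  deranged′ : Derangement ρ
  deranged′ i ρi≡i with toℕ i <? m
  ... | yes i<m = <⇒≱ i<m (subst (λ k → m ≤ toℕ k) ρi≡i (foreign′ i i<m))
  ... | no  i≮m = deranged i (trans (same i (≮⇒≥ i≮m)) ρi≡i)

foreignDerangements : ℕ → ℕ → ℕ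
foreignDerangements n m = ∑ₚ {n} λ π → 𝟙 (foreignDerangement? m π)

derangementsWithMaj : ℕ → ℕ → ℕ → ℕ
derangementsWithMaj n m r = ∑ₚ {n} λ π → 𝟙 (derangement? π) * 𝟙 (maj π ≡? r [mod m ])

foreignWithMaj : ℕ → ℕ → ℕ → ℕ
foreignWithMaj n m r = ∑ₚ {n} λ π → 𝟙 (foreignDerangement? m π) * 𝟙 (maj π ≡? r [mod m ])

module _ (M k : ℕ) where

  private
    n′ m : ℕ
    n′ = suc (k + M)
    m  = suc M

  -- Reindexing by `onHead rotate k` keeps foreign derangements and lowers `maj` by 1 modulo `m`, so
  -- residue `r` after the move is residue `suc r` before it.
  foreignWithMaj-suc : ∀ r → foreignWithMaj n′ m r ≡ foreignWithMaj n′ m (suc r)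
  foreignWithMaj-suc r = trans
    (∑ₚ-bijection (onHead rotate k) (onHead (flip rotate) k)
      (λ {π} {ρ} → onHead-cong rotate k {π} {ρ}) (λ {π} {ρ} → onHead-cong (flip rotate) k {π} {ρ})
      (onHead-inverse rotate (flip rotate) (λ _ → inverseʳ rotate) k)
      (onHead-inverse (flip rotate) rotate (λ _ → inverseˡ rotate) k)
      {λ π → 𝟙 (foreignDerangement? m π) * 𝟙 (maj π ≡? r [mod m ])}
      λ π ρ π≈ρ → cong₂ (λ x y → x * 𝟙 (y ≡? r [mod m ]))
        (𝟙-cong (foreignDerangement? m π) (foreignDerangement? m ρ)
          (foreignDerangement-tail π ρ λ i _ → π≈ρ i)
          (foreignDerangement-tail ρ π λ i _ → sym (π≈ρ i)))
        (maj-cong π ρ π≈ρ))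
    (sum-cong-≗ λ i → step (lookup (permutations n′) i))
    where
    step : ∀ (π : Permutation′ n′) → 𝟙 (foreignDerangement? m (onHead rotate k π)) * 𝟙 (maj (onHead rotate k π) ≡? r [mod m ]) ≡
                 𝟙 (foreignDerangement? m π) * 𝟙 (maj π ≡? suc r [mod m ])
    step π = cong₂ _*_
      (𝟙-cong (foreignDerangement? m π′) (foreignDerangement? m π)
        (foreignDerangement-tail π′ π (onHead-tail rotate k π))
        (foreignDerangement-tail π π′ λ i → sym ∘ onHead-tail rotate k π i))
      -- Congruence of `suc (maj π′)` and `suc r` computes to that of `maj π′` and `r`.
      (𝟙-cong (maj π′ ≡? r [mod m ]) (maj π ≡? suc r [mod m ])
        (≡mod-trans {a = maj π} {suc (maj π′)} {suc r} (≡mod-sym {a = suc (maj π′)} {maj π} (maj-onHead-rotate k π)))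
        (≡mod-trans {a = suc (maj π′)} {maj π} {suc r} (maj-onHead-rotate k π)))
      where π′ = onHead rotate k π

  foreignWithMaj-0 : ∀ r → foreignWithMaj n′ m r ≡ foreignWithMaj n′ m 0
  foreignWithMaj-0 zero    = refl
  foreignWithMaj-0 (suc r) = trans (sym (foreignWithMaj-suc r)) (foreignWithMaj-0 r)

  -- The `m` residue classes are equally large, and together they exhaust the foreign derangements.
  foreign-balanced′ : ∀ r → m * foreignWithMaj n′ m r ≡ foreignDerangements n′ m
  foreign-balanced′ r = begin
    m * foreignWithMaj n′ m r
      ≡⟨ sum-const m (foreignWithMaj n′ m r) ⟨
    ∑[ _ < m ] foreignWithMaj n′ m r
      ≡⟨ sum-cong-≗ {m} (λ s → trans (foreignWithMaj-0 r) (sym (foreignWithMaj-0 (toℕ s)))) ⟩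
    ∑[ s < m ] foreignWithMaj n′ m (toℕ s)
      ≡⟨ ∑-comm (λ s i → term s (lookup (permutations n′) i)) ⟩
    ∑ₚ {n′} (λ π → ∑[ s < m ] term s π)
      ≡⟨ sum-cong-≗ (λ i → total (lookup (permutations n′) i)) ⟩
    foreignDerangements n′ m
      ∎
    where
    open ≡-Reasoning
    term : Fin m → Permutation′ n′ → ℕ
    term s π = 𝟙 (foreignDerangement? m π) * 𝟙 (maj π ≡? toℕ s [mod m ])
    total : ∀ (π : Permutation′ n′) → ∑[ s < m ] term s π ≡ 𝟙 (foreignDerangement? m π)
    total π = begin
      ∑[ s < m ] term s π
        ≡⟨ *-distribˡ-sum (𝟙 (foreignDerangement? m π)) (λ (s : Fin m) → 𝟙 (maj π ≡? toℕ s [mod m ])) ⟨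
      𝟙 (foreignDerangement? m π) * ∑[ s < m ] 𝟙 (maj π ≡? toℕ s [mod m ])
        ≡⟨ cong (𝟙 (foreignDerangement? m π) *_) (residue-sum (maj π)) ⟩
      𝟙 (foreignDerangement? m π) * 1
        ≡⟨ *-identityʳ _ ⟩
      𝟙 (foreignDerangement? m π)
        ∎

foreign-balanced : ∀ {m} .{{_ : NonZero m}} → m ≤ n → ∀ r →
                   m * foreignWithMaj n m r ≡ foreignDerangements n m
foreign-balanced {n} {suc M} m≤n r =
  subst (λ n → suc M * foreignWithMaj n (suc M) r ≡ foreignDerangements n (suc M))
    -- Brings `n` into the form `suc (k + M)` that `onHead` requires.
    (trans (sym (+-suc (n ∸ suc M) M)) (m∸n+n≡m m≤n))
    (foreign-balanced′ M (n ∸ suc M) r)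

-- Derangements sending i to v

derangement-resp : (π ρ : Permutation′ n) → π ≈ ρ → Derangement π → Derangement ρ
derangement-resp π ρ π≈ρ deranged i = deranged i ∘ trans (π≈ρ i)

transpose-first : (u v : Fin n) → transpose u v ⟨$⟩ʳ u ≡ v
transpose-first u v with u Fin.≟ u
... | yes _  = refl
... | no u≢u = contradiction refl u≢u

transpose-second : (u v : Fin n) → transpose u v ⟨$⟩ʳ v ≡ u
transpose-second u v with v Fin.≟ u
... | yes v≡u = v≡u
... | no _ with v Fin.≟ v
...   | yes _  = refl
...   | no v≢v = contradiction refl v≢v

transpose-other : (u v : Fin n) {w : Fin n} → w ≢ u → w ≢ v → transpose u v ⟨$⟩ʳ w ≡ w
transpose-other u v {w} w≢u w≢v with w Fin.≟ u
... | yes w≡u = contradiction w≡u w≢u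
... | no _ with w Fin.≟ v
...   | yes w≡v = contradiction w≡v w≢v
...   | no _    = refl

-- Only two letters change. The letter `v` at position `i` becomes `w`, fixed only if `w` is `i`;
-- the letter `w` becomes `v`, fixed only if it stood at position `v`.
transpose-derangement : (π : Permutation′ n) {i v w : Fin n} → π ⟨$⟩ʳ i ≡ v → w ≢ i → w ≢ π ⟨$⟩ʳ v →
                        Derangement π → Derangement (π ∘ₚ transpose v w)
transpose-derangement {n} π {i} {v} {w} πi≡v w≢i w≢πv deranged j eq = cases (π ⟨$⟩ʳ j Fin.≟ v) (π ⟨$⟩ʳ j Fin.≟ w)
  where
  τ : Permutation′ n
  τ = transpose v w
  cases : Dec (π ⟨$⟩ʳ j ≡ v) → Dec (π ⟨$⟩ʳ j ≡ w) → ⊥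
  cases (yes πj≡v) _ = w≢i (trans (trans (sym (transpose-first v w)) (trans (cong (τ ⟨$⟩ʳ_) (sym πj≡v)) eq))
                                  (⟨$⟩ʳ-injective π (trans πj≡v (sym πi≡v))))
  cases (no _) (yes πj≡w) = w≢πv (trans (sym πj≡w) (cong (π ⟨$⟩ʳ_)
    (trans (sym eq) (trans (cong (τ ⟨$⟩ʳ_) πj≡w) (transpose-second v w)))))
  cases (no πj≢v) (no πj≢w) = deranged j (trans (sym (transpose-other v w πj≢v πj≢w)) eq)

derangements : ℕ → ℕ
derangements n = ∑ₚ {n} λ π → 𝟙 (derangement? π)

DerangementSending : (i v : Fin n) → Pred (Permutation′ n) 0ℓ
DerangementSending i v π = Derangement π × π ⟨$⟩ʳ i ≡ v

derangementSending? : (i v : Fin n) → Decidable (DerangementSending i v)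
derangementSending? i v π = derangement? π ×-dec (π ⟨$⟩ʳ i Fin.≟ v)

derangementsSending : (i v : Fin n) → ℕ
derangementsSending i v = ∑ₚ λ π → 𝟙 (derangementSending? i v π)

∑-derangementsSending : (i : Fin n) → ∑[ v < n ] derangementsSending i v ≡ derangements n
∑-derangementsSending {n} i = trans
  (∑-comm λ v j → 𝟙 (derangementSending? i v (lookup (permutations n) j)))
  (sum-cong-≗ λ j → total (lookup (permutations n) j))
  where
  open ≡-Reasoning
  total : ∀ (π : Permutation′ n) → ∑[ v < n ] 𝟙 (derangementSending? i v π) ≡ 𝟙 (derangement? π)
  total π = begin
    ∑[ v < n ] 𝟙 (derangementSending? i v π)
      ≡⟨ sum-cong-≗ (λ v → 𝟙-× (derangement? π) (π ⟨$⟩ʳ i Fin.≟ v)) ⟩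
    ∑[ v < n ] (𝟙 (derangement? π) * 𝟙 (π ⟨$⟩ʳ i Fin.≟ v))
      ≡⟨ *-distribˡ-sum (𝟙 (derangement? π)) (λ v → 𝟙 (π ⟨$⟩ʳ i Fin.≟ v)) ⟨
    𝟙 (derangement? π) * ∑[ v < n ] 𝟙 (π ⟨$⟩ʳ i Fin.≟ v)
      ≡⟨ cong (𝟙 (derangement? π) *_) (sum-unique (λ v → π ⟨$⟩ʳ i Fin.≟ v) (π ⟨$⟩ʳ i) refl sym) ⟩
    𝟙 (derangement? π) * 1
      ≡⟨ *-identityʳ _ ⟩
    𝟙 (derangement? π) ∎

-- A derangement sending i to v is taken by the transposition of the values v
-- and w to a derangement sending i to w, for all but two values w.

derangementsSending-bound : (i v : Fin n) →
  n * derangementsSending i v ≤ derangements n + 2 * derangementsSending i v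
derangementsSending-bound {n} i v = begin
  n * T
    ≡⟨ sum-const n T ⟨
  ∑[ _ < n ] T
    ≤⟨ sum-mono-≤ (λ w → sum-mono-≤ (λ j → pointwise w (at j))) ⟩
  ∑[ w < n ] ∑ₚ (λ π → moved w π + hit (λ _ → i) w π + hit (_⟨$⟩ʳ v) w π)
    ≡⟨ sum-cong-≗ (λ w → ∑-distrib-+ (λ j → moved w (at j) + hit (λ _ → i) w (at j)) (λ j → hit (_⟨$⟩ʳ v) w (at j))) ⟩
  ∑[ w < n ] (∑ₚ (λ π → moved w π + hit (λ _ → i) w π) + ∑ₚ (hit (_⟨$⟩ʳ v) w))
    ≡⟨ ∑-distrib-+ (λ w → ∑ₚ (λ π → moved w π + hit (λ _ → i) w π)) (λ w → ∑ₚ (hit (_⟨$⟩ʳ v) w)) ⟩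
  ∑[ w < n ] ∑ₚ (λ π → moved w π + hit (λ _ → i) w π) + ∑[ w < n ] ∑ₚ (hit (_⟨$⟩ʳ v) w)
    ≡⟨ cong₂ _+_
         (trans (sum-cong-≗ (λ w → ∑-distrib-+ (λ j → moved w (at j)) (λ j → hit (λ _ → i) w (at j))))
                (∑-distrib-+ (λ w → ∑ₚ (moved w)) (λ w → ∑ₚ (hit (λ _ → i) w))))
         (∑-hit (_⟨$⟩ʳ v)) ⟩
  ∑[ w < n ] ∑ₚ (moved w) + ∑[ w < n ] ∑ₚ (hit (λ _ → i) w) + T
    ≡⟨ cong₂ (λ x y → x + y + T)
         (trans (sum-cong-≗ λ w → sym (∑-moved w)) (∑-derangementsSending i))
         (∑-hit (λ _ → i)) ⟩
  derangements n + T + T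
    ≡⟨ rearrange (derangements n) T ⟩
  derangements n + 2 * T
    ∎
  where
  open ≤-Reasoning
  T = derangementsSending i v
  at = lookup (permutations n)

  moved : Fin n → Permutation′ n → ℕ
  moved w π = 𝟙 (derangementSending? i w (π ∘ₚ transpose v w))

  -- Pays for the exceptional value `f π` of `w`. Summed over `w`, it counts each derangement
  -- sending `i` to `v` once.
  hit : (Permutation′ n → Fin n) → Fin n → Permutation′ n → ℕ
  hit f w π = 𝟙 (w Fin.≟ f π) * 𝟙 (derangementSending? i v π)

  rearrange : ∀ x y → x + y + y ≡ x + 2 * y
  rearrange = solve-∀

  ∑-hit : ∀ f → ∑[ w < n ] ∑ₚ (hit f w) ≡ T
  ∑-hit f = trans (∑-comm (λ w j → hit f w (at j)))
                  (sum-cong-≗ λ j → sum-≟ (λ _ → 𝟙 (derangementSending? i v (at j))) (f (at j)))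

  ∑-moved : ∀ w → derangementsSending i w ≡ ∑ₚ (moved w)
  ∑-moved w = ∑ₚ-bijection (_∘ₚ transpose v w) (_∘ₚ flip (transpose v w))
    (λ π≈ρ j → cong (transpose v w ⟨$⟩ʳ_) (π≈ρ j)) (λ π≈ρ j → cong (flip (transpose v w) ⟨$⟩ʳ_) (π≈ρ j))
    (λ _ _ → inverseʳ (transpose v w)) (λ _ _ → inverseˡ (transpose v w))
    {λ π → 𝟙 (derangementSending? i w π)}
    λ π ρ π≈ρ → 𝟙-cong (derangementSending? i w π) (derangementSending? i w ρ)
      (λ (d , e) → derangement-resp π ρ π≈ρ d , trans (sym (π≈ρ i)) e)
      (λ (d , e) → derangement-resp ρ π (sym ∘ π≈ρ) d , trans (π≈ρ i) e)

  pointwise : ∀ w π → 𝟙 (derangementSending? i v π) ≤ moved w π + hit (λ _ → i) w π + hit (_⟨$⟩ʳ v) w π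
  pointwise w π with w Fin.≟ i | w Fin.≟ (π ⟨$⟩ʳ v)
  -- The product in `hit` is now `1 * x`, which computes to `x + 0`.
  ... | yes _  | _       = ≤-trans (≤-trans (m≤m+n _ 0) (m≤n+m _ (moved w π))) (m≤m+n _ _)
  ... | no _   | yes _   = ≤-trans (m≤m+n _ 0) (m≤n+m _ (moved w π + 0))
  ... | no w≢i | no w≢πv = ≤-trans
    (𝟙-mono (derangementSending? i v π) (derangementSending? i w (π ∘ₚ transpose v w))
      λ (d , e) → transpose-derangement π e w≢i w≢πv d , trans (cong (transpose v w ⟨$⟩ʳ_) e) (transpose-first v w))
    (≤-trans (m≤m+n _ 0) (m≤m+n _ 0))

-- Derangements that are not foreign.

module _ {m : ℕ} (m≤n : m ≤ n) where

  private
    ι : Fin m → Fin n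
    ι a = inject≤ a m≤n

    -- For a derangement, the number of its first `m` letters lying in [m]; for other permutations
    -- 0. It sets up a union bound.
    unforeign : Permutation′ n → ℕ
    unforeign π = ∑[ a < m ] ∑[ b < m ] 𝟙 (derangementSending? (ι a) (ι b) π)

    at = lookup (permutations n)

  unforeignBound : ℕ
  unforeignBound = ∑[ a < m ] ∑[ b < m ] derangementsSending (ι a) (ι b)

  private
    ∑-unforeign : ∑ₚ unforeign ≡ unforeignBound
    ∑-unforeign = sym (trans
      (sum-cong-≗ λ a → ∑-comm (λ b j → 𝟙 (derangementSending? (ι a) (ι b) (at j))))
      (∑-comm (λ a j → ∑[ b < m ] 𝟙 (derangementSending? (ι a) (ι b) (at j)))))

    -- If some head position carries a head value, the corresponding term of the double sum is
    -- already large enough; if none does, the derangement is foreign.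
    split : ∀ π → 𝟙 (derangement? π) ≤ 𝟙 (foreignDerangement? m π) + unforeign π
    split π = cases (Fin.any? λ a → Fin.any? λ b → π ⟨$⟩ʳ ι a Fin.≟ ι b)
      where
      ι-fromℕ< : ∀ {i} (i<m : toℕ i < m) → ι (fromℕ< i<m) ≡ i
      ι-fromℕ< i<m = Fin.toℕ-injective (trans (Fin.toℕ-inject≤ _ m≤n) (Fin.toℕ-fromℕ< i<m))
      cases : Dec (∃[ a ] ∃[ b ] π ⟨$⟩ʳ ι a ≡ ι b) →
              𝟙 (derangement? π) ≤ 𝟙 (foreignDerangement? m π) + unforeign π
      cases (no none) = ≤-trans
        (𝟙-mono (derangement? π) (foreignDerangement? m π) λ d → d , λ i i<m → ≮⇒≥ λ v<m →
          none (fromℕ< i<m , fromℕ< v<m , trans (cong (π ⟨$⟩ʳ_) (ι-fromℕ< i<m)) (sym (ι-fromℕ< v<m))))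
        (m≤m+n _ _)
      cases (yes (a , b , πa≡b)) = begin
        𝟙 (derangement? π)                                    ≤⟨ 𝟙-mono (derangement? π) (derangementSending? (ι a) (ι b) π) (_, πa≡b) ⟩
        𝟙 (derangementSending? (ι a) (ι b) π)                 ≤⟨ f≤sum (λ b → 𝟙 (derangementSending? (ι a) (ι b) π)) b ⟩
        ∑[ b < m ] 𝟙 (derangementSending? (ι a) (ι b) π)      ≤⟨ f≤sum (λ a → ∑[ b < m ] 𝟙 (derangementSending? (ι a) (ι b) π)) a ⟩
        unforeign π                                           ≤⟨ m≤n+m _ _ ⟩
        𝟙 (foreignDerangement? m π) + unforeign π             ∎
        where open ≤-Reasoning

  derangements-split : derangements n ≤ foreignDerangements n m + unforeignBound
  derangements-split = begin
    derangements n                                              ≤⟨ sum-mono-≤ (λ j → split (at j)) ⟩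
    ∑ₚ (λ π → 𝟙 (foreignDerangement? m π) + unforeign π)        ≡⟨ ∑-distrib-+ (λ j → 𝟙 (foreignDerangement? m (at j))) (λ j → unforeign (at j)) ⟩
    foreignDerangements n m + ∑ₚ unforeign                      ≡⟨ cong (foreignDerangements n m +_) ∑-unforeign ⟩
    foreignDerangements n m + unforeignBound                    ∎
    where open ≤-Reasoning

  -- This is `split` multiplied by the indicator of the residue, which is at most 1 and may be
  -- dropped from the error term.
  withMaj-split : ∀ r → derangementsWithMaj n m r ≤ foreignWithMaj n m r + unforeignBound
  withMaj-split r = begin
    derangementsWithMaj n m r
      ≤⟨ sum-mono-≤ (λ j → pointwise (at j)) ⟩
    ∑ₚ (λ π → 𝟙 (foreignDerangement? m π) * 𝟙 (maj π ≡? r [mod m ]) + unforeign π)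
      ≡⟨ ∑-distrib-+ (λ j → 𝟙 (foreignDerangement? m (at j)) * 𝟙 (maj (at j) ≡? r [mod m ])) (λ j → unforeign (at j)) ⟩
    foreignWithMaj n m r + ∑ₚ unforeign
      ≡⟨ cong (foreignWithMaj n m r +_) ∑-unforeign ⟩
    foreignWithMaj n m r + unforeignBound
      ∎
    where
    open ≤-Reasoning
    𝟙≤1 : (A? : Dec A) → 𝟙 A? ≤ 1
    𝟙≤1 (yes _) = ≤-refl
    𝟙≤1 (no  _) = z≤n
    pointwise : ∀ π → 𝟙 (derangement? π) * 𝟙 (maj π ≡? r [mod m ]) ≤
                      𝟙 (foreignDerangement? m π) * 𝟙 (maj π ≡? r [mod m ]) + unforeign π
    pointwise π = begin
      𝟙 (derangement? π) * μ                                    ≤⟨ *-monoˡ-≤ μ (split π) ⟩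
      (𝟙 (foreignDerangement? m π) + unforeign π) * μ           ≡⟨ *-distribʳ-+ μ (𝟙 (foreignDerangement? m π)) (unforeign π) ⟩
      𝟙 (foreignDerangement? m π) * μ + unforeign π * μ         ≤⟨ +-monoʳ-≤ _ (*-monoʳ-≤ (unforeign π) (𝟙≤1 (maj π ≡? r [mod m ]))) ⟩
      𝟙 (foreignDerangement? m π) * μ + unforeign π * 1         ≡⟨ cong (𝟙 (foreignDerangement? m π) * μ +_) (*-identityʳ _) ⟩
      𝟙 (foreignDerangement? m π) * μ + unforeign π             ∎
      where μ = 𝟙 (maj π ≡? r [mod m ])

unforeignBound-≤ : ∀ {m} (m≤2+n : m ≤ 2+ n) → n * unforeignBound m≤2+n ≤ m * (m * derangements (2+ n))
unforeignBound-≤ {n} {m} m≤2+n = begin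
  n * unforeignBound m≤2+n
    ≡⟨ *-distribˡ-sum n (λ a → ∑[ b < m ] derangementsSending (ι a) (ι b)) ⟩
  ∑[ a < m ] (n * ∑[ b < m ] derangementsSending (ι a) (ι b))
    ≤⟨ sum-mono-≤ (λ a → begin
         n * ∑[ b < m ] derangementsSending (ι a) (ι b)       ≡⟨ *-distribˡ-sum n (λ b → derangementsSending (ι a) (ι b)) ⟩
         ∑[ b < m ] (n * derangementsSending (ι a) (ι b))     ≤⟨ sum-mono-≤ (λ b → bound (ι a) (ι b)) ⟩
         ∑[ b < m ] derangements (2+ n)                       ≡⟨ sum-const m (derangements (2+ n)) ⟩
         m * derangements (2+ n)                              ∎) ⟩
  ∑[ _ < m ] (m * derangements (2+ n))
    ≡⟨ sum-const m (m * derangements (2+ n)) ⟩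
  m * (m * derangements (2+ n))
    ∎
  where
  open ≤-Reasoning
  ι : Fin m → Fin (2+ n)
  ι a = inject≤ a m≤2+n
  bound : ∀ i v → n * derangementsSending i v ≤ derangements (2+ n)
  -- On `2+ n` letters the two exceptional values cancel and leave the factor `n`.
  bound i v = +-cancelˡ-≤ (2 * T) _ _ (begin
    2 * T + n * T                ≡⟨ *-distribʳ-+ T 2 n ⟨
    (2 + n) * T                  ≤⟨ derangementsSending-bound i v ⟩
    derangements (2+ n) + 2 * T  ≡⟨ +-comm _ (2 * T) ⟩
    2 * T + derangements (2+ n)  ∎)
    where T = derangementsSending i v

-- Existence of derangements.

rotate-derangement : Derangement (rotate {suc n})
rotate-derangement i with view i
... | ‵fromℕ     = λ e → contradiction (trans (sym rotate-fromℕ) e) λ ()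
... | ‵inject₁ j = λ e → inject₁≢suc j (trans (sym e) (rotate-inject₁ j))

-- The list holds a permutation pointwise equal to the cyclic shift, and that entry is counted.
-- Positivity makes the quotient defined.
derangements>0 : ∀ n → 0 < derangements (2+ n)
derangements>0 n = begin-strict
  0                                       <⟨ z<s ⟩
  1                                       ≡⟨ 𝟙-yes (derangement? π) deranged ⟨
  𝟙 (derangement? π)                      ≤⟨ f≤sum (λ j → 𝟙 (derangement? (lookup (permutations (2+ n)) j))) position ⟩
  derangements (2+ n)                     ∎
  where
  open ≤-Reasoning
  position = index (permutations-complete (rotate {suc n}))
  π = lookup (permutations (2+ n)) position
  deranged = derangement-resp rotate π (lookup-index (permutations-complete (rotate {suc n}))) rotate-derangement

-- The error estimate

∣-∣-least : ∀ {x y z} → x ≤ y + z → y ≤ x + z → ∣ x - y ∣ ≤ z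
∣-∣-least {x} {y} {z} x≤y+z y≤x+z with ≤-total x y
... | inj₁ x≤y = subst (_≤ z) (sym (m≤n⇒∣m-n∣≡n∸m x≤y)) (m≤n+o⇒m∸n≤o y x y≤x+z)
... | inj₂ y≤x = subst (_≤ z) (trans (sym (m≤n⇒∣m-n∣≡n∸m y≤x)) (∣-∣-comm y x)) (m≤n+o⇒m∸n≤o x y x≤y+z)

-- Both `Dᵣ * m` and `D` lie between `F` and `F + m * X`, because `m * Fᵣ` equals `F` by
-- `foreign-balanced`.
balance-error : ∀ {m} .{{_ : NonZero m}} (m≤n : m ≤ n) r →
                ∣ derangementsWithMaj n m r * m - derangements n ∣ ≤ m * unforeignBound m≤n
balance-error {n} {m} m≤n r = ∣-∣-least
  (begin
    Dᵣ * m               ≡⟨ *-comm Dᵣ m ⟩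
    m * Dᵣ               ≤⟨ *-monoʳ-≤ m (withMaj-split m≤n r) ⟩
    m * (Fᵣ + X)         ≡⟨ *-distribˡ-+ m Fᵣ X ⟩
    m * Fᵣ + m * X       ≡⟨ cong (_+ m * X) (foreign-balanced m≤n r) ⟩
    F + m * X           ≤⟨ +-monoˡ-≤ (m * X) (sum-mono-≤ λ j → FD≤D (lookup (permutations n) j)) ⟩
    D + m * X           ∎)
  (begin
    D                   ≤⟨ derangements-split m≤n ⟩
    F + X               ≤⟨ +-monoʳ-≤ F (m≤n*m X m) ⟩
    F + m * X           ≡⟨ cong (_+ m * X) (foreign-balanced m≤n r) ⟨
    m * Fᵣ + m * X       ≤⟨ +-monoˡ-≤ (m * X) (*-monoʳ-≤ m (sum-mono-≤ λ j →
                             *-monoˡ-≤ (𝟙 (maj (lookup (permutations n) j) ≡? r [mod m ])) (FD≤D (lookup (permutations n) j)))) ⟩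
    m * Dᵣ + m * X       ≡⟨ cong (_+ m * X) (*-comm m Dᵣ) ⟩
    Dᵣ * m + m * X       ∎)
  where
  open ≤-Reasoning
  Fᵣ = foreignWithMaj n m r
  Dᵣ = derangementsWithMaj n m r
  D = derangements n
  F = foreignDerangements n m
  X = unforeignBound m≤n
  FD≤D : ∀ (π : Permutation′ n) → 𝟙 (foreignDerangement? m π) ≤ 𝟙 (derangement? π)
  FD≤D π = 𝟙-mono (foreignDerangement? m π) (derangement? π) proj₁

-- For positive `X`, chain `m * m * q * X < n * X` with the first hypothesis and cancel `m * m`. For
-- `X` zero the strict inequality comes from `0 < D`.
small-error : ∀ {m n q X D} .{{_ : NonZero m}} → n * X ≤ m * (m * D) → m * m * q < n → 0 < D → q * X < D
small-error {m} {n} {q} {zero}  {D} _ _ 0<D = subst (_< D) (sym (*-zeroʳ q)) 0<D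
small-error {m} {n} {q} {suc X} {D} nX≤mmD mmq<n _ = *-cancelˡ-< (m * m) (q * suc X) D (begin-strict
  m * m * (q * suc X)  ≡⟨ *-assoc (m * m) q (suc X) ⟨
  m * m * q * suc X    <⟨ *-monoˡ-< (suc X) mmq<n ⟩
  n * suc X            ≤⟨ nX≤mmD ⟩
  m * (m * D)          ≡⟨ *-assoc m m D ⟨
  m * m * D            ∎)
  where open ≤-Reasoning

-- Passage to rational numbers.

∣⊖∣≡∣-∣ : ∀ x y → ℤ.∣ x ℤ.⊖ y ∣ ≡ ∣ x - y ∣
∣⊖∣≡∣-∣ x y with ≤-total x y
... | inj₁ x≤y = trans (ℤ.∣⊖∣-≤ x≤y) (sym (m≤n⇒∣m-n∣≡n∸m x≤y))
... | inj₂ y≤x = trans (trans (ℤ.∣m⊖n∣≡∣n⊖m∣ x y) (ℤ.∣⊖∣-≤ y≤x)) (sym (trans (∣-∣-comm x y) (m≤n⇒∣m-n∣≡n∸m y≤x)))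

-- The difference of the quotients is `a * m - d` over `d * m`. Unnormalised rationals keep this
-- form, with no common factors cancelled, so cross multiplication applies directly.
close-quotients : ∀ a d m .{{_ : NonZero d}} .{{_ : NonZero m}} ε → 0ℚ ℚ.< ε →
  ∣ a * m - d ∣ * ℚ.↧ₙ ε < d * m → ℚ.∣ ℤ.+ a ℚ./ d ℚ.- 1ℤ ℚ./ m ∣ ℚ.< ε
close-quotients a (suc d) (suc m) ε@(ℚ.mkℚ (ℤ.+ suc e) q-1 _) _ close = ℚ.toℚᵘ-cancel-< (begin-strict
  ℚ.toℚᵘ ℚ.∣ x ℚ.- y ∣              ≃⟨ ℚ.toℚᵘ-homo-∣-∣ (x ℚ.- y) ⟩
  ℚᵘ.∣ ℚ.toℚᵘ (x ℚ.- y) ∣           ≃⟨ ℚᵘ.∣-∣-cong (ℚᵘ.≃-trans (ℚ.toℚᵘ-homo-+ x (ℚ.- y)) (ℚᵘ.+-cong (ℚ.toℚᵘ-fromℚᵘ xᵘ)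
                                       (ℚᵘ.≃-trans (ℚ.toℚᵘ-homo‿- y) (ℚᵘ.-‿cong (ℚ.toℚᵘ-fromℚᵘ yᵘ))))) ⟩
  ℚᵘ.∣ xᵘ ℚᵘ.- yᵘ ∣                 <⟨ ℚᵘ.*<* cross-multiplied ⟩
  ℚ.toℚᵘ ε                          ∎)
  where
  open ℚᵘ.≤-Reasoning
  x  = ℤ.+ a ℚ./ suc d
  y  = 1ℤ ℚ./ suc m
  xᵘ = ℚᵘ.mkℚᵘ (ℤ.+ a) d
  yᵘ = ℚᵘ.mkℚᵘ 1ℤ m
  numerator : ℤ.∣ ℚᵘ.↥ (xᵘ ℚᵘ.- yᵘ) ∣ ≡ ∣ a * suc m - suc d ∣
  numerator = trans
    (cong ℤ.∣_∣ (trans (cong₂ ℤ._+_ (sym (ℤ.pos-* a (suc m))) (ℤ.-1*i≡-i (ℤ.+ suc d))) (ℤ.m-n≡m⊖n (a * suc m) (suc d))))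
    (∣⊖∣≡∣-∣ (a * suc m) (suc d))
  cross-multiplied : ℤ.+ ℤ.∣ ℚᵘ.↥ (xᵘ ℚᵘ.- yᵘ) ∣ ℤ.* ℤ.+ suc q-1 ℤ.< ℤ.+ suc e ℤ.* ℤ.+ (suc d * suc m)
  cross-multiplied = subst₂ ℤ._<_
    (trans (ℤ.pos-* ∣ a * suc m - suc d ∣ (suc q-1)) (cong (λ k → ℤ.+ k ℤ.* ℤ.+ suc q-1) (sym numerator)))
    (ℤ.pos-* (suc e) (suc d * suc m))
    -- The numerator `suc e` of `ε` is at least 1, so multiplying by it only enlarges the right
    -- side.
    (ℤ.+<+ (<-≤-trans close (m≤m+n (suc d * suc m) (e * (suc d * suc m)))))
close-quotients _ _ _ (ℚ.mkℚ ℤ.+0 _ _)      (ℚ.*<* (ℤ.+<+ ())) _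
close-quotients _ _ _ (ℚ.mkℚ -[1+ _ ] _ _) (ℚ.*<* ()) _

-- The limit.

count-derangements : ∀ n → count {n} derangement? ≡ derangements n
count-derangements n = count-∑ₚ {n} derangement?

count-derangementsWithMaj : ∀ n m r →
  count {n} (derangement? ∩? λ π → maj π ≡? r [mod m ]) ≡ derangementsWithMaj n m r
count-derangementsWithMaj n m r = trans (count-∑ₚ {n} (derangement? ∩? λ π → maj π ≡? r [mod m ]))
  (sum-cong-≗ λ j → let π = lookup (permutations n) j in 𝟙-× (derangement? π) (maj π ≡? r [mod m ]))

theorem2 : HasBalancedProperty derangement? maj
-- Two of the 3 are the letters set aside by `2+ n`, and the third makes `m * m * q < n` strict; the
-- summand `m` ensures that the head fits into the word.
theorem2 m r r<m ε 0<ε = 3 + (m * m * q + m) , λ { (suc (suc n)) (s≤s (s≤s N≤n)) → close n N≤n }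
  where
  instance
    m≢0 : NonZero m
    m≢0 = nonTrivial⇒nonZero m
  q = ℚ.↧ₙ ε
  -- Bundling the proof that `d` is nonzero lets both counts be rewritten at once.
  Close : ℕ → ℕ → Set
  Close a d = Σ[ d≢0 ∈ NonZero d ] ℚ.∣ ℚ._/_ (ℤ.+ a) d {{d≢0}} ℚ.- 1ℤ ℚ./ m ∣ ℚ.< ε
  close-positive : ∀ a d → 0 < d → ∣ a * m - d ∣ * q < d * m → Close a d
  close-positive a d 0<d error = >-nonZero 0<d , close-quotients a d m {{>-nonZero 0<d}} ε 0<ε error
  close : ∀ n → suc (m * m * q + m) ≤ n →
          Close (count {2+ n} (derangement? ∩? λ π → maj π ≡? r [mod m ])) (count {2+ n} derangement?)
  close n N≤n = subst₂ Close (sym (count-derangementsWithMaj (2+ n) m r)) (sym (count-derangements (2+ n)))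
    (close-positive (derangementsWithMaj (2+ n) m r) (derangements (2+ n)) (derangements>0 n) (begin-strict
      -- The factor `m` of the error estimate is absorbed by the `m` in the denominator `d * m`,
      -- which leaves `q * X` to be compared with the number of derangements.
      ∣ derangementsWithMaj (2+ n) m r * m - derangements (2+ n) ∣ * q  ≤⟨ *-monoˡ-≤ q (balance-error m≤2+n r) ⟩
      m * X * q                                                          ≡⟨ rearrange m X q ⟩
      q * X * m                                                          <⟨ *-monoˡ-< m (small-error {m} {n} {q} {X} {derangements (2+ n)} (unforeignBound-≤ m≤2+n) mmq<n (derangements>0 n)) ⟩
      derangements (2+ n) * m                                            ∎))
    where
    open ≤-Reasoning
    m≤2+n : m ≤ 2+ n
    m≤2+n = ≤-trans (≤-trans (m≤n+m m (suc (m * m * q))) N≤n) (m≤n+m n 2)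
    mmq<n : m * m * q < n
    mmq<n = ≤-trans (s≤s (m≤m+n (m * m * q) m)) N≤n
    X = unforeignBound m≤2+n
    rearrange : ∀ x y z → x * y * z ≡ z * y * x
    rearrange = solve-∀
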